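{- Let $n \geq 5$ be an integer. Let $G_{\mathrm{pr}}(\mathbb{F}_2^n)$ be the phase-rotation distance graph over $\mathbb{F}_2$, and let $\alpha_3$ denote the $3$-independence number. Then \[ \alpha_3(G_{\mathrm{pr}}(\mathbb{F}_2^n)) \leq \begin{cases} 2^{n-1} \frac{n^2-n+4}{n^2(n+4)} & \text{if } n \equiv 0 \pmod 4, \\ 2^{n-1} \frac{n-3}{(n-1)(n+3)} & \text{if } n \equiv 1 \pmod 4, \\ 2^{n-1} \frac{n-5}{(n+2)(n-2)} & \text{if } n \equiv 2 \pmod 4, \\ 2^{n-1} \frac{1}{n+1} & \text{if } n \equiv 3 \pmod 4. \end{cases} \]
   Context: Let $q$ be a prime power (here $q=2$). Let $\mathbf{e}_1,\ldots,\mathbf{e}_n$ be the standard basis of $\mathbb{F}_q^n$ and $\mathbf{1}$ the all-ones vector. Put $F_i=\mathrm{span}(\mathbf{e}_i)$ for $i=1,\ldots,n$ and $F_{n+1}=\mathrm{span}(\mathbf{1})$. The phase-rotation weight of $\mathbf{x}\in\mathbb{F}_q^n$ is $w_{\mathrm{pr}}(\mathbf{x})=\min\{|I| : I\subseteq\{1,\ldots,n+1\},\ \mathbf{x}\in\mathrm{span}(\bigcup_{i\in I}F_i)\}$, and the phase-rotation distance is $d_{\mathrm{pr}}(\mathbf{x},\mathbf{y})=w_{\mathrm{pr}}(\mathbf{x}-\mathbf{y})$. The phase-rotation distance graph $G_{\mathrm{pr}}(\mathbb{F}_q^n)$ is the graph with vertex set $\mathbb{F}_q^n$ in which $\mathbf{x},\mathbf{y}$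 are adjacent if and only if $d_{\mathrm{pr}}(\mathbf{x},\mathbf{y})=1$. For a graph $G$, the $k$-independence number $\alpha_k(G)$ is the size of the largest set of vertices such that any two distinct vertices in the set are at geodesic distance greater than $k$ in $G$. -}

module Defs where

open import Data.Bool using (Bool; true; false; _∧_; _xor_)
import Data.Bool.Properties as Bool
open import Data.Fin using (Fin; zero; suc; inject₁)
open import Data.Fin.Patterns using (0F; 1F; 2F; 3F)
import Data.Fin.Properties as Fin
open import Data.Fin.Subset using (Subset; ∣_∣; ⁅_⁆; ⊤; ⊥) renaming (_∈_ to _∈ˢ_)
open import Data.Fin.Subset.Properties using (anySubset?; ∣⊥∣≡0; ∈⊤)
open import Data.Integer using (+_)
open import Data.Nat using (ℕ; zero; suc; _+_; _*_; _∸_; _^_; _≤_; _<_; z≤n; s≤s; NonZero; >-nonZero)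
import Data.Nat.Properties as ℕ
open import Data.Product using (∃; _×_; _,_; proj₁; proj₂)
open import Data.Product.Function.NonDependent.Propositional using (_×-↔_)
open import Data.Rational.Unnormalised using (ℚᵘ) renaming (_/_ to _/ᵘ_; _*_ to _*ᵘ_)
open import Data.Vec using (Vec; []; _∷_; _∷ʳ_; map; zipWith; replicate; tabulate; lookup; _[_]≔_; here; there)
import Data.Vec.Properties as Vec
open import Data.Vec.Membership.Propositional using (_∈_)
open import Data.Vec.Relation.Unary.All as All using (All; []; _∷_)
open import Data.Vec.Relation.Unary.Any as Any using ()
open import Data.Vec.Relation.Unary.AllPairs using (allPairs?)
open import Data.Vec.Relation.Unary.Unique.Propositional using (Unique; [])
open import Data.Vec.Relation.Unary.Unique.Propositional.Properties using (lookup-injective)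
open import Function using (_↔_; _∘_; mk↔ₛ′)
open import Function.Bundles using (module Injection; module Inverse)
open import Function.Construct.Composition using (_↔-∘_)
open import Function.Properties.Inverse using (↔-sym; Inverse⇒Injection)
open import Level using (0ℓ)
open import Relation.Binary using (Rel; Decidable; Symmetric; Irreflexive; DecidableEquality)
open import Relation.Binary.PropositionalEquality
open import Relation.Nullary using (Dec; yes; no; contradiction)
open import Relation.Nullary.Decidable using (map′; _×-dec_; _→-dec_; ¬?; via-injection)
open import Relation.Unary as Pred using (Pred; ｛_｝)

IsLeast IsGreatest : Pred ℕ 0ℓ → Pred ℕ 0ℓ
IsLeast    P m = P m × (∀ {k} → P k → m ≤ k)
IsGreatest P m = P m × (∀ {k} → P k → k ≤ m)

least : ∀ {P : Pred ℕ 0ℓ} → Pred.Decidable P → ∀ m → P m → ∃ (IsLeast P)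
least P? zero p = 0 , p , λ _ → z≤n
least {P} P? (suc m) p with P? 0
... | yes p₀ = 0 , p₀ , λ _ → z≤n
... | no ¬p₀ with least (P? ∘ suc) m p
...   | l , pl , min = suc l , pl , min′
  where
  min′ : ∀ {k} → P k → suc l ≤ k
  min′ {zero}  pk = contradiction pk ¬p₀
  min′ {suc k} pk = s≤s (min pk)

greatest : ∀ {P : Pred ℕ 0ℓ} → Pred.Decidable P → P 0 →
           ∀ m → (∀ {k} → P k → k ≤ m) → ∃ (IsGreatest P)
greatest P? p₀ zero bnd = 0 , p₀ , bnd
greatest {P} P? p₀ (suc m) bnd with P? (suc m)
... | yes p = suc m , p , bnd
... | no ¬p = greatest P? p₀ m λ pk →
        ℕ.≤-pred (ℕ.≤∧≢⇒< (bnd pk) λ { refl → ¬p pk })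

allOf∈ : ∀ {A : Set} {P : Pred A 0ℓ} {m} {xs : Vec A m} →
         (∀ {x} → x ∈ xs → P x) → All P xs
allOf∈ {xs = []}     h = []
allOf∈ {xs = x ∷ xs} h = h (Any.here refl) ∷ allOf∈ (h ∘ Any.there)

record Graph : Set₁ where
  infix 4 _~_ _~?_
  field
    Vertex : Set
    order  : ℕ
    index  : Vertex ↔ Fin order
    _~_    : Rel Vertex 0ℓ
    _~?_   : Decidable _~_
    sym~   : Symmetric _~_
    irr~   : Irreflexive _≡_ _~_

  data Walk : ℕ → Rel Vertex 0ℓ where
    []  : ∀ {x} → Walk 0 x x
    _∷_ : ∀ {l x y z} → x ~ y → Walk l y z → Walk (suc l) x z

  -- The geodesic distance (the least length of a walk, infinite if there is
  -- no walk) exceeds k.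
  Distance> : ℕ → Rel Vertex 0ℓ
  Distance> k x y = ∀ {l} → Walk l x y → k < l

  -- A set of m vertices is a duplicate-free vector of length m.
  record IsIndependent (k : ℕ) {m} (xs : Vec Vertex m) : Set where
    pattern
    constructor _,_
    field
      unique : Unique xs
      far    : ∀ {x y} → x ∈ xs → y ∈ xs → x ≢ y → Distance> k x y

  HasIndependentSet : ℕ → Pred ℕ 0ℓ
  HasIndependentSet k m = ∃ λ (xs : Vec Vertex m) → IsIndependent k xs

  -- The remaining facts only ensure that the independence numbers exist.

  _≟ᵛ_ : DecidableEquality Vertex
  _≟ᵛ_ = via-injection (Inverse⇒Injection index) Fin._≟_

  any? : ∀ {P : Pred Vertex 0ℓ} → Pred.Decidable P → Dec (∃ P)
  any? {P} P? = map′
    (λ (i , p) → from i , p)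
    (λ (x , p) → to x , subst P (sym (strictlyInverseʳ x)) p)
    (Fin.any? (P? ∘ from))
    where open Inverse index

  anyVec? : ∀ {m} {P : Pred (Vec Vertex m) 0ℓ} → Pred.Decidable P → Dec (∃ P)
  anyVec? {zero}  P? = map′ ([] ,_) (λ { ([] , p) → p }) (P? [])
  anyVec? {suc m} P? = map′
    (λ (x , xs , p) → x ∷ xs , p)
    (λ { (x ∷ xs , p) → x , xs , p })
    (any? λ x → anyVec? λ xs → P? (x ∷ xs))

  walk? : ∀ l → Decidable (Walk l)
  walk? zero    x y = map′ (λ { refl → [] }) (λ { [] → refl }) (x ≟ᵛ y)
  walk? (suc l) x z = map′
    (λ (y , e , w) → e ∷ w) (λ { (e ∷ w) → _ , e , w })
    (any? λ y → x ~? y ×-dec walk? l y z)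

  distance>? : ∀ k → Decidable (Distance> k)
  distance>? k x y = map′
    (λ f {l} w → ℕ.≰⇒> λ l≤k → f (s≤s l≤k) w)
    (λ f {l} l<1+k w → ℕ.<⇒≱ (f w) (ℕ.≤-pred l<1+k))
    (ℕ.allUpTo? (λ l → ¬? (walk? l x y)) (suc k))

  isIndependent? : ∀ k {m} (xs : Vec Vertex m) → Dec (IsIndependent k xs)
  isIndependent? k xs = map′
    (λ (u , ds) → u , λ x∈ y∈ → All.lookup (All.lookup ds x∈) y∈)
    (λ (u , f) → u , allOf∈ λ x∈ → allOf∈ λ y∈ → f x∈ y∈)
    (allPairs? (λ x y → ¬? (x ≟ᵛ y)) xs ×-dec
     All.all? (λ x → All.all? (λ y → ¬? (x ≟ᵛ y) →-dec distance>? k x y) xs) xs)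

  size≤order : ∀ {k m} → HasIndependentSet k m → m ≤ order
  size≤order (xs , u , _) = Fin.injective⇒≤ {f = Inverse.to index ∘ lookup xs}
    λ {i} {j} eq → lookup-injective u i j (Injection.injective (Inverse⇒Injection index) eq)

  independenceNumber : ∀ k → ∃ (IsGreatest (HasIndependentSet k))
  independenceNumber k = greatest
    (λ m → anyVec? (isIndependent? k)) ([] , [] , λ ()) order size≤order

α : ℕ → Graph → ℕ
α k G = proj₁ (Graph.independenceNumber G k)

-- The two-element field is Bool with _xor_ as addition and _∧_ as
-- multiplication.
F₂ : Set
F₂ = Bool

F₂^_ : ℕ → Set
F₂^ n = Vec F₂ n

infixl 6 _⊕_ _⊖_
infixr 7 _·_

_⊕_ _⊖_ : ∀ {n} → F₂^ n → F₂^ n → F₂^ n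
_⊕_ = zipWith _xor_
-- Negation in F₂ is the identity.
_⊖_ = _⊕_

_·_ : ∀ {n} → F₂ → F₂^ n → F₂^ n
a · x = map (a ∧_) x

𝟎 𝟏 : ∀ {n} → F₂^ n
𝟎 = replicate _ false
𝟏 = replicate _ true

e : ∀ {n} → Fin n → F₂^ n
e i = 𝟎 [ i ]≔ true

data Span {n} (S : Pred (F₂^ n) 0ℓ) : Pred (F₂^ n) 0ℓ where
  gen   : ∀ {x} → S x → Span S x
  zeroˢ : Span S 𝟎
  _+ˢ_  : ∀ {x y} → Span S x → Span S y → Span S (x ⊕ y)
  _·ˢ_  : ∀ a {x} → Span S x → Span S (a · x)

generators : ∀ n → Vec (F₂^ n) (suc n)
generators n = tabulate e ∷ʳ 𝟏

F : ∀ {n} → Fin (suc n) → Pred (F₂^ n) 0ℓ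
F i = Span ｛ lookup (generators _) i ｝

⋃F : ∀ {n} → Subset (suc n) → Pred (F₂^ n) 0ℓ
⋃F I x = ∃ λ i → i ∈ˢ I × F i x

SpannedBy : ∀ {n} → F₂^ n → Pred ℕ 0ℓ
SpannedBy {n} x w = ∃ λ (I : Subset (suc n)) → ∣ I ∣ ≡ w × Span (⋃F I) x

-- The next facts, up to `weight`, only ensure that the minimum defining the
-- weight exists.

⊕-assoc : ∀ {n} (x y z : F₂^ n) → (x ⊕ y) ⊕ z ≡ x ⊕ (y ⊕ z)
⊕-assoc = Vec.zipWith-assoc Bool.xor-assoc

⊕-comm : ∀ {n} (x y : F₂^ n) → x ⊕ y ≡ y ⊕ x
⊕-comm = Vec.zipWith-comm Bool.xor-comm

⊕-identityˡ : ∀ {n} (x : F₂^ n) → 𝟎 ⊕ x ≡ x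
⊕-identityˡ = Vec.zipWith-identityˡ Bool.xor-identityˡ

⊕-identityʳ : ∀ {n} (x : F₂^ n) → x ⊕ 𝟎 ≡ x
⊕-identityʳ = Vec.zipWith-identityʳ Bool.xor-identityʳ

⊕-self : ∀ {n} (x : F₂^ n) → x ⊕ x ≡ 𝟎
⊕-self []      = refl
⊕-self (a ∷ x) = cong₂ _∷_ (Bool.xor-same a) (⊕-self x)

false· : ∀ {n} (x : F₂^ n) → false · x ≡ 𝟎
false· x = Vec.map-const x false

true· : ∀ {n} (x : F₂^ n) → true · x ≡ x
true· = Vec.map-id

interchange : ∀ {n} (x y z w : F₂^ n) → (x ⊕ y) ⊕ (z ⊕ w) ≡ (x ⊕ z) ⊕ (y ⊕ w)
interchange x y z w = begin
  (x ⊕ y) ⊕ (z ⊕ w)  ≡⟨ ⊕-assoc x y (z ⊕ w) ⟩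
  x ⊕ (y ⊕ (z ⊕ w))  ≡⟨ cong (x ⊕_) (⊕-assoc y z w) ⟨
  x ⊕ ((y ⊕ z) ⊕ w)  ≡⟨ cong (λ v → x ⊕ (v ⊕ w)) (⊕-comm y z) ⟩
  x ⊕ ((z ⊕ y) ⊕ w)  ≡⟨ cong (x ⊕_) (⊕-assoc z y w) ⟩
  x ⊕ (z ⊕ (y ⊕ w))  ≡⟨ ⊕-assoc x z (y ⊕ w) ⟨
  (x ⊕ z) ⊕ (y ⊕ w)  ∎
  where open ≡-Reasoning

combination : ∀ {m n} → Subset m → Vec F₂ m → Vec (F₂^ n) m → F₂^ n
combination []      []       []       = 𝟎
combination (i ∷ I) (c ∷ cs) (f ∷ fs) = (i ∧ c) · f ⊕ combination I cs fs

combination-𝟎 : ∀ {m n} I (fs : Vec (F₂^ n) m) → combination I 𝟎 fs ≡ 𝟎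
combination-𝟎 []      []       = refl
combination-𝟎 (i ∷ I) (f ∷ fs) = begin
  (i ∧ false) · f ⊕ combination I 𝟎 fs
    ≡⟨ cong₂ (λ a v → a · f ⊕ v) (Bool.∧-zeroʳ i) (combination-𝟎 I fs) ⟩
  false · f ⊕ 𝟎  ≡⟨ ⊕-identityʳ _ ⟩
  false · f      ≡⟨ false· f ⟩
  𝟎              ∎
  where open ≡-Reasoning

·-distribʳ : ∀ {n} i a b (f : F₂^ n) →
             (i ∧ (a xor b)) · f ≡ (i ∧ a) · f ⊕ (i ∧ b) · f
·-distribʳ i a b []      = refl
·-distribʳ i a b (x ∷ f) = cong₂ _∷_ (lemma i a b x) (·-distribʳ i a b f)
  where
  lemma : ∀ i a b x → (i ∧ (a xor b)) ∧ x ≡ ((i ∧ a) ∧ x) xor ((i ∧ b) ∧ x)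
  lemma false a     b     x = refl
  lemma true  false b     x = refl
  lemma true  true  false x = sym (Bool.xor-identityʳ x)
  lemma true  true  true  x = sym (Bool.xor-same x)

combination-⊕ : ∀ {m n} I cs ds (fs : Vec (F₂^ n) m) →
  combination I (cs ⊕ ds) fs ≡ combination I cs fs ⊕ combination I ds fs
combination-⊕ [] [] [] [] = sym (⊕-identityˡ 𝟎)
combination-⊕ (i ∷ I) (c ∷ cs) (d ∷ ds) (f ∷ fs) = trans
  (cong₂ _⊕_ (·-distribʳ i c d f) (combination-⊕ I cs ds fs))
  (interchange ((i ∧ c) · f) ((i ∧ d) · f) (combination I cs fs) (combination I ds fs))

combination-· : ∀ {m n} I a cs (fs : Vec (F₂^ n) m) →
  combination I (a · cs) fs ≡ a · combination I cs fs
combination-· I false cs fs = trans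
  (cong (λ v → combination I v fs) (false· cs))
  (trans (combination-𝟎 I fs) (sym (false· _)))
combination-· I true cs fs = trans
  (cong (λ v → combination I v fs) (true· cs)) (sym (true· _))

combination-⁅⁆ : ∀ {m n} {I : Subset m} {i} (fs : Vec (F₂^ n) m) → i ∈ˢ I →
  combination I ⁅ i ⁆ fs ≡ lookup fs i
combination-⁅⁆ {I = _ ∷ I} (f ∷ fs) here = begin
  true · f ⊕ combination I 𝟎 fs  ≡⟨ cong₂ _⊕_ (true· f) (combination-𝟎 I fs) ⟩
  f ⊕ 𝟎                          ≡⟨ ⊕-identityʳ f ⟩
  f                              ∎
  where open ≡-Reasoning
combination-⁅⁆ {I = j ∷ I} {suc i} (f ∷ fs) (there i∈I) = begin
  (j ∧ false) · f ⊕ combination I ⁅ i ⁆ fs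
    ≡⟨ cong₂ (λ a v → a · f ⊕ v) (Bool.∧-zeroʳ j) (combination-⁅⁆ fs i∈I) ⟩
  false · f ⊕ lookup fs i  ≡⟨ cong (_⊕ lookup fs i) (false· f) ⟩
  𝟎 ⊕ lookup fs i          ≡⟨ ⊕-identityˡ _ ⟩
  lookup fs i              ∎
  where open ≡-Reasoning

Combination : ∀ {n} → Subset (suc n) → Pred (F₂^ n) 0ℓ
Combination I x = ∃ λ cs → combination I cs (generators _) ≡ x

span-combination : ∀ {n} {I : Subset (suc n)} {S : Pred (F₂^ n) 0ℓ} →
  (∀ {x} → S x → Combination I x) → ∀ {x} → Span S x → Combination I x
span-combination S⊆ (gen s) = S⊆ s
span-combination {I = I} S⊆ zeroˢ = 𝟎 , combination-𝟎 I (generators _)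
span-combination {I = I} S⊆ (s +ˢ t)
  with cs , refl ← span-combination {I = I} S⊆ s
     | ds , refl ← span-combination {I = I} S⊆ t
  = cs ⊕ ds , combination-⊕ I cs ds (generators _)
span-combination {I = I} S⊆ (a ·ˢ s)
  with cs , refl ← span-combination {I = I} S⊆ s
  = a · cs , combination-· I a cs (generators _)

combination-complete : ∀ {n} {I : Subset (suc n)} {x} → Span (⋃F I) x → Combination I x
combination-complete {I = I} = span-combination {I = I} λ (i , i∈I , s) →
  span-combination {I = I} (λ { refl → ⁅ i ⁆ , combination-⁅⁆ (generators _) i∈I }) s

combination-span : ∀ {m n} {S : Pred (F₂^ n) 0ℓ} (I : Subset m) cs fs →
  (∀ {i} → i ∈ˢ I → Span S (lookup fs i)) → Span S (combination I cs fs)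
combination-span []          []       []       h = zeroˢ
combination-span {S = S} (false ∷ I) (c ∷ cs) (f ∷ fs) h =
  subst (λ v → Span S (v ⊕ combination I cs fs)) (sym (false· f))
    (zeroˢ +ˢ combination-span I cs fs (h ∘ there))
combination-span (true ∷ I) (c ∷ cs) (f ∷ fs) h =
  (c ·ˢ h here) +ˢ combination-span I cs fs (h ∘ there)

combination-sound : ∀ {n} {I : Subset (suc n)} {x} → Combination I x → Span (⋃F I) x
combination-sound {I = I} (cs , refl) =
  combination-span I cs (generators _) λ {i} i∈I → gen (i , i∈I , gen refl)

span? : ∀ {n} (I : Subset (suc n)) → Pred.Decidable (Span (⋃F I))
span? I x = map′ combination-sound combination-complete
  (anySubset? λ cs → Vec.≡-dec Bool._≟_ (combination I cs (generators _)) x)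

span-∷ : ∀ {n} {S : Pred (F₂^ suc n) 0ℓ} {x} →
         Span (λ y → S (false ∷ y)) x → Span S (false ∷ x)
span-∷ (gen s)  = gen s
span-∷ zeroˢ    = zeroˢ
span-∷ (s +ˢ t) = span-∷ s +ˢ span-∷ t
span-∷ {S = S} (_·ˢ_ a {x} s) =
  subst (λ b → Span S (b ∷ a · x)) (Bool.∧-zeroʳ a) (a ·ˢ span-∷ s)

span-e : ∀ {n} {S : Pred (F₂^ n) 0ℓ} → (∀ i → S (e i)) → ∀ x → Span S x
span-e h []          = zeroˢ
span-e h (false ∷ x) = span-∷ (span-e (h ∘ suc) x)
span-e {S = S} h (true ∷ x) = subst (λ v → Span S (true ∷ v)) (⊕-identityˡ x)
  (gen (h zero) +ˢ span-∷ (span-e (h ∘ suc) x))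

lookup-∷ʳ : ∀ {A : Set} {m} (xs : Vec A m) a i → lookup (xs ∷ʳ a) (inject₁ i) ≡ lookup xs i
lookup-∷ʳ (x ∷ xs) a zero    = refl
lookup-∷ʳ (x ∷ xs) a (suc i) = lookup-∷ʳ xs a i

spanned : ∀ {n} (x : F₂^ n) → SpannedBy x ∣ ⊤ {suc n} ∣
spanned x = ⊤ , refl , span-e
  (λ i → inject₁ i , ∈⊤ ,
    gen (trans (lookup-∷ʳ (tabulate e) 𝟏 i) (Vec.lookup∘tabulate e i))) x

weight : ∀ {n} (x : F₂^ n) → ∃ (IsLeast (SpannedBy x))
weight x = least
  (λ w → anySubset? λ I → (∣ I ∣ ℕ.≟ w) ×-dec span? I x) _ (spanned x)

w-pr : ∀ {n} → F₂^ n → ℕ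
w-pr x = proj₁ (weight x)

d-pr : ∀ {n} → F₂^ n → F₂^ n → ℕ
d-pr x y = w-pr (x ⊖ y)

d-pr-self : ∀ {n} (x : F₂^ n) → d-pr x x ≡ 0
d-pr-self {n} x = ℕ.n≤0⇒n≡0 (proj₂ (proj₂ (weight (x ⊖ x)))
  (⊥ , ∣⊥∣≡0 (suc n) , subst (Span (⋃F ⊥)) (sym (⊕-self x)) zeroˢ))

index-F₂^ : ∀ n → F₂^ n ↔ Fin (2 ^ n)
index-F₂^ zero    = mk↔ₛ′ (λ _ → zero) (λ _ → []) (λ { zero → refl }) (λ { [] → refl })
index-F₂^ (suc n) = ↔-sym Fin.*↔× ↔-∘ ((↔-sym Fin.2↔Bool ×-↔ index-F₂^ n) ↔-∘ uncons↔)
  where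
  uncons↔ : F₂^ suc n ↔ (F₂ × F₂^ n)
  uncons↔ = mk↔ₛ′ (λ { (a ∷ x) → a , x }) (λ (a , x) → a ∷ x)
                  (λ _ → refl) (λ { (a ∷ x) → refl })

G-pr : ℕ → Graph
G-pr n = record
  { Vertex = F₂^ n
  ; order  = 2 ^ n
  ; index  = index-F₂^ n
  ; _~_    = λ x y → d-pr x y ≡ 1
  ; _~?_   = λ x y → d-pr x y ℕ.≟ 1
  ; sym~   = λ {x} {y} → trans (cong w-pr (⊕-comm y x))
  ; irr~   = λ { {x} refl eq → contradiction (trans (sym (d-pr-self x)) eq) λ () }
  }

*-nonZero : ∀ {a b} → 0 < a → 0 < b → NonZero (a * b)
*-nonZero {a} {b} a>0 b>0 = ℕ.m*n≢0 a b {{>-nonZero a>0}} {{>-nonZero b>0}}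

∸-pos : ∀ {n} m → m < 5 → 5 ≤ n → 0 < n ∸ m
∸-pos m m<5 n≥5 = ℕ.m<n⇒0<n∸m (ℕ.<-≤-trans m<5 n≥5)

+-pos : ∀ n m → 0 < n + suc m
+-pos n m = ℕ.≤-trans (s≤s z≤n) (ℕ.m≤n+m (suc m) n)

den₀ : ∀ {n} → 5 ≤ n → NonZero (n ^ 2 * (n + 4))
den₀ {n} n≥5 = *-nonZero
  (ℕ.m^n>0 n {{>-nonZero (ℕ.≤-trans (s≤s z≤n) n≥5)}} 2) (+-pos n 3)

den₁ : ∀ {n} → 5 ≤ n → NonZero ((n ∸ 1) * (n + 3))
den₁ {n} n≥5 = *-nonZero (∸-pos 1 (ℕ.m≤m+n 2 3) n≥5) (+-pos n 2)

den₂ : ∀ {n} → 5 ≤ n → NonZero ((n + 2) * (n ∸ 2))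
den₂ {n} n≥5 = *-nonZero (+-pos n 1) (∸-pos 2 (ℕ.m≤m+n 3 2) n≥5)

den₃ : ∀ n → NonZero (n + 1)
den₃ n = >-nonZero (+-pos n 0)

-- No truncated subtraction underflows, since 5 ≤ n.
bound : ∀ n → 5 ≤ n → Fin 4 → ℚᵘ
bound n n≥5 r = (+ (2 ^ (n ∸ 1)) /ᵘ 1) *ᵘ fraction r
  where
  fraction : Fin 4 → ℚᵘ
  fraction 0F = _/ᵘ_ (+ (n ^ 2 ∸ n + 4)) (n ^ 2 * (n + 4))   {{den₀ n≥5}}
  fraction 1F = _/ᵘ_ (+ (n ∸ 3))         ((n ∸ 1) * (n + 3)) {{den₁ n≥5}}
  fraction 2F = _/ᵘ_ (+ (n ∸ 5))         ((n + 2) * (n ∸ 2)) {{den₂ n≥5}}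
  fraction 3F = _/ᵘ_ (+ 1)               (n + 1)             {{den₃ n}}

{-# OPTIONS --safe #-}
-- The graph is a Cayley graph of F₂ⁿ (the folded (n+1)-cube), so its eigenvalues are the character
-- sums θ u = Σ_g (-1)^(u·g) over the N = n + 1 generators g, and θ u ≡ N (mod 4) with θ u ≥ -N.
-- For a cubic polynomial q ≥ 0 on all eigenvalues, and C a set of vertices at pairwise distance
-- greater than 3, q(A) vanishes between distinct vertices of C, whence by Fourier inversion
--   q(N) |C|² ≤ Σ_u q(θ u) |Ĉ(u)|² = |C| Σ_u q(θ u).
-- The right-hand side only involves the first three moments of θ, which are 0, N and 0.
-- The roots of q are the least eigenvalue and two consecutive members of N + 4ℤ around 0.

module Submission where

open import Defs
open import Data.Nat using (ℕ; _≤_)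
open import Data.Nat.DivMod using (_mod_)
open import Data.Integer using (+_)
import Data.Rational.Unnormalised as ℚᵘ
open import Data.Bool using (true; false)
open import Data.Fin using (Fin; zero; suc; toℕ)
open import Data.Fin.Patterns using (0F; 1F; 2F; 3F)
open import Data.Fin.Subset using (Subset; ∣_∣; ⁅_⁆) renaming (_∈_ to _∈ˢ_)
open import Data.Fin.Subset.Properties using (∣⁅x⁆∣≡1; x∈⁅x⁆)
open import Data.Integer as ℤ using (ℤ; -[1+_]; 0ℤ; 1ℤ; -1ℤ; _+_; _*_; -_; _-_; +≤+)
import Data.Integer.Properties as ℤ
open import Data.Integer.Tactic.RingSolver using (solve-∀)
open import Data.Nat using (zero; suc; z≤n; s≤s; NonZero)
open import Data.Nat.Tactic.RingSolver using () renaming (solve-∀ to ℕ-solve-∀)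
import Data.Nat as ℕ
import Data.Nat.Properties as ℕ
open import Data.Nat.DivMod using (_divMod_; module DivMod)
open import Data.Product using (∃; _×_; _,_; proj₁; proj₂)
open import Data.Sum using (_⊎_; inj₁; inj₂)
open import Data.Vec using (Vec; []; _∷_; _∷ʳ_; tabulate; lookup; tail; there)
open import Data.Vec.Relation.Unary.All as All using (All; []; _∷_)
import Data.Vec.Relation.Unary.All.Properties as All
open import Data.Vec.Relation.Unary.AllPairs as AllPairs using (AllPairs; []; _∷_)
open import Data.Vec.Relation.Unary.Any as Any using ()
open import Function using (_∘_)
open import Relation.Binary.PropositionalEquality
open import Relation.Nullary using (contradiction)

-- Sums over the vectors of F₂ⁿ

-- Opaque, so that summands can be inferred by unification.
opaque
  ∑ : ∀ n → (F₂^ n → ℤ) → ℤ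
  ∑ zero    f = f []
  ∑ (suc n) f = ∑ n λ u → f (false ∷ u) + f (true ∷ u)

  ∑-zero : ∀ f → ∑ 0 f ≡ f []
  ∑-zero f = refl

  ∑-suc : ∀ n f → ∑ (suc n) f ≡ ∑ n λ u → f (false ∷ u) + f (true ∷ u)
  ∑-suc n f = refl

  ∑-cong : ∀ n {f g} → (∀ u → f u ≡ g u) → ∑ n f ≡ ∑ n g
  ∑-cong zero    f≗g = f≗g []
  ∑-cong (suc n) f≗g = ∑-cong n λ u → cong₂ _+_ (f≗g (false ∷ u)) (f≗g (true ∷ u))

  ∑-+ : ∀ n f g → ∑ n (λ u → f u + g u) ≡ ∑ n f + ∑ n g
  ∑-+ zero    f g = refl
  ∑-+ (suc n) f g = trans
    (∑-cong n λ u → medial (f (false ∷ u)) (g (false ∷ u)) (f (true ∷ u)) (g (true ∷ u)))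
    (∑-+ n _ _)
    where
    medial : ∀ a b c d → (a + b) + (c + d) ≡ (a + c) + (b + d)
    medial = solve-∀

  ∑-* : ∀ n c f → ∑ n (λ u → c * f u) ≡ c * ∑ n f
  ∑-* zero    c f = refl
  ∑-* (suc n) c f = trans
    (∑-cong n λ u → sym (ℤ.*-distribˡ-+ c (f (false ∷ u)) (f (true ∷ u)))) (∑-* n c _)

  ∑-0 : ∀ n → ∑ n (λ _ → 0ℤ) ≡ 0ℤ
  ∑-0 zero    = refl
  ∑-0 (suc n) = ∑-0 n

  ∑-1 : ∀ n → ∑ n (λ _ → 1ℤ) ≡ + (2 ℕ.^ n)
  ∑-1 zero    = refl
  ∑-1 (suc n) = begin
    ∑ n (λ _ → + 2 * 1ℤ)  ≡⟨ ∑-* n (+ 2) (λ _ → 1ℤ) ⟩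
    + 2 * ∑ n (λ _ → 1ℤ)  ≡⟨ cong (+ 2 *_) (∑-1 n) ⟩
    + 2 * + (2 ℕ.^ n)     ≡⟨ ℤ.pos-* 2 (2 ℕ.^ n) ⟨
    + (2 ℕ.^ suc n)       ∎
    where open ≡-Reasoning

  -- Isolates the trivial character `𝟎`, at which the eigenvalue equals the degree; the other terms
  -- are nonnegative and can only add to it.
  term≤∑ : ∀ n {f} → (∀ u → 0ℤ ℤ.≤ f u) → f 𝟎 ℤ.≤ ∑ n f
  term≤∑ zero    f≥0 = ℤ.≤-refl
  term≤∑ (suc n) {f} f≥0 = ℤ.≤-trans
    (ℤ.i≤i+j (f 𝟎) (f (true ∷ 𝟎)) {{ℤ.nonNegative (f≥0 (true ∷ 𝟎))}})
    (term≤∑ n λ u → ℤ.+-mono-≤ (f≥0 (false ∷ u)) (f≥0 (true ∷ u)))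

-- Characters of F₂ⁿ

-- χ u x is the character (-1)^(u·x).
σ : F₂ → ℤ
σ false = 1ℤ
σ true  = -1ℤ

χ : ∀ {n} → F₂^ n → F₂^ n → ℤ
χ []      []          = 1ℤ
χ (a ∷ u) (false ∷ x) = χ u x
χ (a ∷ u) (true ∷ x)  = σ a * χ u x

σ² : ∀ a → σ a * σ a ≡ 1ℤ
σ² false = refl
σ² true  = refl

χ-𝟎ʳ : ∀ {n} (u : F₂^ n) → χ u 𝟎 ≡ 1ℤ
χ-𝟎ʳ []      = refl
χ-𝟎ʳ (a ∷ u) = χ-𝟎ʳ u

χ-𝟎ˡ : ∀ {n} (x : F₂^ n) → χ 𝟎 x ≡ 1ℤ
χ-𝟎ˡ []          = refl
χ-𝟎ˡ (false ∷ x) = χ-𝟎ˡ x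
χ-𝟎ˡ (true ∷ x)  = trans (ℤ.*-identityˡ _) (χ-𝟎ˡ x)

χ-⊕ : ∀ {n} (u x y : F₂^ n) → χ u (x ⊕ y) ≡ χ u x * χ u y
χ-⊕ []      []          []          = refl
χ-⊕ (a ∷ u) (false ∷ x) (false ∷ y) = χ-⊕ u x y
χ-⊕ (a ∷ u) (false ∷ x) (true ∷ y)  = trans (cong (σ a *_) (χ-⊕ u x y)) (perm (σ a) (χ u x) (χ u y))
  where
  perm : ∀ a b c → a * (b * c) ≡ b * (a * c)
  perm = solve-∀
χ-⊕ (a ∷ u) (true ∷ x)  (false ∷ y) =
  trans (cong (σ a *_) (χ-⊕ u x y)) (sym (ℤ.*-assoc (σ a) (χ u x) (χ u y)))
χ-⊕ (a ∷ u) (true ∷ x)  (true ∷ y)  = begin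
  χ u (x ⊕ y)                        ≡⟨ χ-⊕ u x y ⟩
  χ u x * χ u y                      ≡⟨ ℤ.*-identityˡ _ ⟨
  1ℤ * (χ u x * χ u y)               ≡⟨ cong (_* (χ u x * χ u y)) (σ² a) ⟨
  σ a * σ a * (χ u x * χ u y)        ≡⟨ medial (σ a) (σ a) (χ u x) (χ u y) ⟩
  σ a * χ u x * (σ a * χ u y)        ∎
  where
  open ≡-Reasoning
  medial : ∀ a b c d → a * b * (c * d) ≡ a * c * (b * d)
  medial = solve-∀

χ² : ∀ {n} (u x : F₂^ n) → χ u x * χ u x ≡ 1ℤ
χ² u x = begin
  χ u x * χ u x  ≡⟨ χ-⊕ u x x ⟨
  χ u (x ⊕ x)    ≡⟨ cong (χ u) (⊕-self x) ⟩
  χ u 𝟎          ≡⟨ χ-𝟎ʳ u ⟩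
  1ℤ             ∎
  where open ≡-Reasoning

-- Induction on `x`: at a leading `true` the two values of the first coordinate of `u` contribute
-- opposite terms, while a leading `false` merely doubles the sum for the tail.
χ-orthogonal : ∀ n {x : F₂^ n} → x ≢ 𝟎 → ∑ n (λ u → χ u x) ≡ 0ℤ
χ-orthogonal zero    {[]}        x≢𝟎 = contradiction refl x≢𝟎
χ-orthogonal (suc n) {false ∷ x} x≢𝟎 = begin
  ∑ (suc n) (λ u → χ u (false ∷ x))        ≡⟨ ∑-suc n _ ⟩
  ∑ n (λ u → χ u x + χ u x)                ≡⟨ ∑-+ n _ _ ⟩
  ∑ n (λ u → χ u x) + ∑ n (λ u → χ u x)    ≡⟨ cong₂ _+_ ih ih ⟩
  0ℤ                                       ∎
  where
  open ≡-Reasoning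
  ih = χ-orthogonal n (x≢𝟎 ∘ cong (false ∷_))
χ-orthogonal (suc n) {true ∷ x} x≢𝟎 = trans (∑-suc n _) (trans (∑-cong n λ u → cancel (χ u x)) (∑-0 n))
  where
  cancel : ∀ a → 1ℤ * a + -1ℤ * a ≡ 0ℤ
  cancel = solve-∀

-- Fourier transforms of vertex sets

-- The Fourier transform of the indicator function of a set of vectors.
hat : ∀ {n m} → Vec (F₂^ n) m → F₂^ n → ℤ
hat []       u = 0ℤ
hat (x ∷ xs) u = χ u x + hat xs u

-- By linearity. In `∑-hat²` the vector `xs` is the rest of an independent set; in `orthogonal-θ` it
-- is the vector of generators.
∑-hat : ∀ {n m} (w : F₂^ n → ℤ) {xs : Vec (F₂^ n) m} →
        All (λ x → ∑ n (λ u → w u * χ u x) ≡ 0ℤ) xs → ∑ n (λ u → w u * hat xs u) ≡ 0ℤ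
∑-hat {n} w [] = trans (∑-cong n λ u → ℤ.*-zeroʳ (w u)) (∑-0 n)
∑-hat {n} w {x ∷ xs} (eq ∷ eqs) = begin
  ∑ n (λ u → w u * (χ u x + hat xs u))                    ≡⟨ ∑-cong n (λ u → ℤ.*-distribˡ-+ (w u) (χ u x) (hat xs u)) ⟩
  ∑ n (λ u → w u * χ u x + w u * hat xs u)                ≡⟨ ∑-+ n _ _ ⟩
  ∑ n (λ u → w u * χ u x) + ∑ n (λ u → w u * hat xs u)    ≡⟨ cong₂ _+_ eq (∑-hat w eqs) ⟩
  0ℤ                                                      ∎
  where open ≡-Reasoning

hat-𝟎 : ∀ {n m} (xs : Vec (F₂^ n) m) → hat xs 𝟎 ≡ + m
hat-𝟎 []       = refl
hat-𝟎 (x ∷ xs) = cong₂ _+_ (χ-𝟎ˡ x) (hat-𝟎 xs)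

hat-∷ʳ : ∀ {n m} (xs : Vec (F₂^ n) m) x u → hat (xs ∷ʳ x) u ≡ hat xs u + χ u x
hat-∷ʳ []       x u = ℤ.+-comm (χ u x) 0ℤ
hat-∷ʳ (y ∷ xs) x u = trans (cong (_+_ (χ u y)) (hat-∷ʳ xs x u)) (sym (ℤ.+-assoc (χ u y) (hat xs u) (χ u x)))

-- Expanding the square, only the diagonal pairs survive.
∑-hat² : ∀ {n m} (w : F₂^ n → ℤ) {xs : Vec (F₂^ n) m} →
         AllPairs (λ x y → ∑ n (λ u → w u * χ u (x ⊕ y)) ≡ 0ℤ) xs →
         ∑ n (λ u → w u * (hat xs u * hat xs u)) ≡ + m * ∑ n w
∑-hat² {n} w [] = trans (∑-cong n λ u → ℤ.*-zeroʳ (w u)) (∑-0 n)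
∑-hat² {n} {suc m} w {x ∷ xs} (eqs ∷ eqss) = begin
  ∑ n (λ u → w u * ((χ u x + hat xs u) * (χ u x + hat xs u)))
    ≡⟨ ∑-cong n (λ u → trans (expand (w u) (χ u x) (hat xs u))
         (cong (λ a → w u * a + (+ 2 * (w u * χ u x * hat xs u) + w u * (hat xs u * hat xs u))) (χ² u x))) ⟩
  ∑ n (λ u → w u * 1ℤ + (+ 2 * (w u * χ u x * hat xs u) + w u * (hat xs u * hat xs u)))
    ≡⟨ trans (∑-+ n _ _) (cong (_+_ (∑ n (λ u → w u * 1ℤ))) (∑-+ n _ _)) ⟩
  ∑ n (λ u → w u * 1ℤ) + (∑ n (λ u → + 2 * (w u * χ u x * hat xs u)) + ∑ n (λ u → w u * (hat xs u * hat xs u)))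
    ≡⟨ cong₂ _+_ (∑-cong n λ u → ℤ.*-identityʳ (w u)) (cong₂ _+_ cross (∑-hat² w eqss)) ⟩
  ∑ n w + (0ℤ + + m * ∑ n w)
    ≡⟨ collect (+ m) (∑ n w) ⟩
  + suc m * ∑ n w ∎
  where
  open ≡-Reasoning
  expand : ∀ w a b → w * ((a + b) * (a + b)) ≡ w * (a * a) + (+ 2 * (w * a * b) + w * (b * b))
  expand = solve-∀
  collect : ∀ m a → a + (0ℤ + m * a) ≡ (1ℤ + m) * a
  collect = solve-∀
  cross : ∑ n (λ u → + 2 * (w u * χ u x * hat xs u)) ≡ 0ℤ
  cross = trans (∑-* n (+ 2) _) (cong (+ 2 *_) (∑-hat (λ u → w u * χ u x)
    (All.map (λ {y} eq → trans (∑-cong n λ u → trans (ℤ.*-assoc (w u) _ _) (cong (w u *_) (sym (χ-⊕ u x y)))) eq) eqs)))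

-- The eigenvalues of the graph

-- Being the transform of the generators, the eigenvalue at `χ u` falls under `∑-hat`, and `hat-𝟎`
-- evaluates it at `𝟎` to the degree `n + 1`.
θ : ∀ {n} → F₂^ n → ℤ
θ u = hat (generators _) u

signSum : ∀ {n} → F₂^ n → ℤ
signSum []      = 0ℤ
signSum (a ∷ u) = σ a + signSum u

hat-e : ∀ {n} (u : F₂^ n) → hat (tabulate e) u ≡ signSum u
hat-e []      = refl
hat-e {suc n} (a ∷ u) = cong₂ _+_ (trans (cong (σ a *_) (χ-𝟎ʳ u)) (ℤ.*-identityʳ (σ a)))
  (trans (shift e) (hat-e u))
  where
  shift : ∀ {m} (f : Fin m → F₂^ n) → hat (tabulate (λ i → false ∷ f i)) (a ∷ u) ≡ hat (tabulate f) u
  shift {zero}  f = refl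
  shift {suc m} f = cong (_+_ (χ u (f zero))) (shift (f ∘ suc))

-- Separates the sum of the signs of `u` from their product `χ u 𝟏`. Both change simply when one
-- coordinate is split off, so mixed moments can be computed by recursion on the dimension.
θ-signSum : ∀ {n} (u : F₂^ n) → θ u ≡ signSum u + χ u 𝟏
θ-signSum u = trans (hat-∷ʳ (tabulate e) 𝟏 u) (cong (_+ χ u 𝟏) (hat-e u))

-- If `u` has h entries `true`, then `signSum u` is n - 2h and `χ u 𝟏` is (-1)^h. The two
-- alternatives are h = 2j and h = 2j + 1.
signs : ∀ {n} (u : F₂^ n) → ∃ λ j →
  (2 ℕ.* j ≤ n × signSum u ≡ + n - + 4 * + j × χ u 𝟏 ≡ 1ℤ) ⊎
  (suc (2 ℕ.* j) ≤ n × signSum u ≡ + n - + 4 * + j - + 2 × χ u 𝟏 ≡ -1ℤ)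
signs [] = 0 , inj₁ (z≤n , refl , refl)
signs {suc n} (false ∷ u) with signs u
... | j , inj₁ (b , eq , p) = j , inj₁ (ℕ.m≤n⇒m≤1+n b , trans (cong (_+_ 1ℤ) eq) (ring (+ n) (+ j)) , cong (1ℤ *_) p)
  where
  ring : ∀ n j → 1ℤ + (n - + 4 * j) ≡ 1ℤ + n - + 4 * j
  ring = solve-∀
... | j , inj₂ (b , eq , p) = j , inj₂ (ℕ.m≤n⇒m≤1+n b , trans (cong (_+_ 1ℤ) eq) (ring (+ n) (+ j)) , cong (1ℤ *_) p)
  where
  ring : ∀ n j → 1ℤ + (n - + 4 * j - + 2) ≡ 1ℤ + n - + 4 * j - + 2
  ring = solve-∀
signs {suc n} (true ∷ u) with signs u
... | j , inj₁ (b , eq , p) = j , inj₂ (s≤s b , trans (cong (_+_ -1ℤ) eq) (ring (+ n) (+ j)) , cong (-1ℤ *_) p)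
  where
  ring : ∀ n j → -1ℤ + (n - + 4 * j) ≡ 1ℤ + n - + 4 * j - + 2
  ring = solve-∀
... | j , inj₂ (b , eq , p) = suc j , inj₁
  ( subst (_≤ suc n) (sym (ℕ.*-suc 2 j)) (s≤s b)
  , trans (cong (_+_ -1ℤ) eq) (ring (+ n) (+ j)) , cong (-1ℤ *_) p)
  where
  ring : ∀ n j → -1ℤ + (n - + 4 * j - + 2) ≡ 1ℤ + n - + 4 * (1ℤ + j)
  ring = solve-∀

-- The sign `χ u 𝟏` rounds h, the number of entries `true`, up to an even number: `θ u` is n + 1 -
-- 4j with j = ⌈h/2⌉.
θ-values : ∀ {n} (u : F₂^ n) → ∃ λ j → 2 ℕ.* j ≤ suc n × θ u ≡ + suc n - + 4 * + j
θ-values {n} u with signs u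
... | j , inj₁ (b , eq , p) = j , ℕ.m≤n⇒m≤1+n b ,
  trans (θ-signSum u) (trans (cong₂ _+_ eq p) (ring (+ n) (+ j)))
  where
  ring : ∀ n j → n - + 4 * j + 1ℤ ≡ 1ℤ + n - + 4 * j
  ring = solve-∀
... | j , inj₂ (b , eq , p) = suc j , subst (_≤ suc n) (sym (ℕ.*-suc 2 j)) (s≤s b) ,
  trans (θ-signSum u) (trans (cong₂ _+_ eq p) (ring (+ n) (+ j)))
  where
  ring : ∀ n j → n - + 4 * j - + 2 + -1ℤ ≡ 1ℤ + n - + 4 * (1ℤ + j)
  ring = solve-∀

-- Strips the vanishing terms one by one from the right-nested expansion in `∑-cubic`.
∑-drop : ∀ n c {f g} → ∑ n f ≡ 0ℤ → ∑ n (λ u → c * f u + g u) ≡ ∑ n g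
∑-drop n c {f} {g} eq = begin
  ∑ n (λ u → c * f u + g u)          ≡⟨ ∑-+ n _ _ ⟩
  ∑ n (λ u → c * f u) + ∑ n g        ≡⟨ cong (_+ ∑ n g) (∑-* n c f) ⟩
  c * ∑ n f + ∑ n g                  ≡⟨ cong (λ a → c * a + ∑ n g) eq ⟩
  c * 0ℤ + ∑ n g                     ≡⟨ cong (_+ ∑ n g) (ℤ.*-zeroʳ c) ⟩
  0ℤ + ∑ n g                         ≡⟨ ℤ.+-identityˡ _ ⟩
  ∑ n g                              ∎
  where open ≡-Reasoning

∑-scaled-0 : ∀ n c {f} → ∑ n f ≡ 0ℤ → ∑ n (λ u → c * f u) ≡ 0ℤ
∑-scaled-0 n c {f} eq = trans (∑-* n c f) (trans (cong (c *_) eq) (ℤ.*-zeroʳ c))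

-- Moments of the eigenvalues

∑-s : ∀ n → ∑ n signSum ≡ 0ℤ
∑-s zero    = ∑-zero _
∑-s (suc n) = trans (∑-suc n _) (trans (∑-cong n λ u → ring (signSum u)) (∑-scaled-0 n (+ 2) (∑-s n)))
  where
  ring : ∀ s → 1ℤ + s + (-1ℤ + s) ≡ + 2 * s
  ring = solve-∀

-- This is the variance `n` of a sum of `n` independent random signs, times the number of vectors.
∑-s² : ∀ n → ∑ n (λ u → signSum u * signSum u) ≡ + n * + (2 ℕ.^ n)
∑-s² zero    = ∑-zero _
∑-s² (suc n) = begin
  ∑ (suc n) (λ u → signSum u * signSum u)
    ≡⟨ ∑-suc n _ ⟩
  ∑ n (λ u → (1ℤ + signSum u) * (1ℤ + signSum u) + (-1ℤ + signSum u) * (-1ℤ + signSum u))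
    ≡⟨ ∑-cong n (λ u → ring (signSum u)) ⟩
  ∑ n (λ u → + 2 * (signSum u * signSum u) + + 2 * 1ℤ)
    ≡⟨ ∑-+ n _ _ ⟩
  ∑ n (λ u → + 2 * (signSum u * signSum u)) + ∑ n (λ _ → + 2 * 1ℤ)
    ≡⟨ cong₂ _+_ (trans (∑-* n (+ 2) _) (cong (+ 2 *_) (∑-s² n))) (trans (∑-* n (+ 2) _) (cong (+ 2 *_) (∑-1 n))) ⟩
  + 2 * (+ n * + (2 ℕ.^ n)) + + 2 * + (2 ℕ.^ n)
    ≡⟨ collect (+ n) (+ (2 ℕ.^ n)) ⟩
  + suc n * (+ 2 * + (2 ℕ.^ n))
    ≡⟨ cong (+ suc n *_) (ℤ.pos-* 2 (2 ℕ.^ n)) ⟨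
  + suc n * + (2 ℕ.^ suc n) ∎
  where
  open ≡-Reasoning
  ring : ∀ s → (1ℤ + s) * (1ℤ + s) + (-1ℤ + s) * (-1ℤ + s) ≡ + 2 * (s * s) + + 2 * 1ℤ
  ring = solve-∀
  collect : ∀ n a → + 2 * (n * a) + + 2 * a ≡ (1ℤ + n) * (+ 2 * a)
  collect = solve-∀

∑-s³ : ∀ n → ∑ n (λ u → signSum u * signSum u * signSum u) ≡ 0ℤ
∑-s³ zero    = ∑-zero _
∑-s³ (suc n) = trans (∑-suc n _) (trans (∑-cong n λ u → ring (signSum u))
  (trans (∑-drop n (+ 2) (∑-s³ n)) (∑-scaled-0 n (+ 6) (∑-s n))))
  where
  ring : ∀ s → (1ℤ + s) * (1ℤ + s) * (1ℤ + s) + (-1ℤ + s) * (-1ℤ + s) * (-1ℤ + s) ≡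
               + 2 * (s * s * s) + + 6 * s
  ring = solve-∀

𝟏≢𝟎 : ∀ {n} → 𝟏 {suc n} ≢ 𝟎
𝟏≢𝟎 ()

∑-p : ∀ n → ∑ (suc n) (λ u → χ u 𝟏) ≡ 0ℤ
∑-p n = χ-orthogonal (suc n) 𝟏≢𝟎

-- Splitting off the first sign flips the product of signs along with it, so one power of `signSum`
-- is lost and one dimension is used up. In dimension 1 the sum would be 2.
∑-sp : ∀ n → ∑ (2 ℕ.+ n) (λ u → signSum u * χ u 𝟏) ≡ 0ℤ
∑-sp n = trans (∑-suc (suc n) _)
  (trans (∑-cong (suc n) λ u → ring (signSum u) (χ u 𝟏)) (∑-scaled-0 (suc n) (+ 2) (∑-p n)))
  where
  ring : ∀ s p → (1ℤ + s) * (1ℤ * p) + (-1ℤ + s) * (-1ℤ * p) ≡ + 2 * p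
  ring = solve-∀

-- The same descent once more, whence dimension at least 3; in dimension 2 the sum would be 8.
∑-s²p : ∀ n → ∑ (3 ℕ.+ n) (λ u → signSum u * signSum u * χ u 𝟏) ≡ 0ℤ
∑-s²p n = trans (∑-suc (2 ℕ.+ n) _)
  (trans (∑-cong (2 ℕ.+ n) λ u → ring (signSum u) (χ u 𝟏)) (∑-scaled-0 (2 ℕ.+ n) (+ 4) (∑-sp n)))
  where
  ring : ∀ s p → (1ℤ + s) * (1ℤ + s) * (1ℤ * p) + (-1ℤ + s) * (-1ℤ + s) * (-1ℤ * p) ≡ + 4 * (s * p)
  ring = solve-∀

-- The roots are `- a`, `- b`, `- c`. The factored form serves both sign and orthogonality, which
-- are established one factor at a time.
cubic : ∀ {n} → ℤ → ℤ → ℤ → F₂^ n → ℤ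
cubic a b c u = (θ u + a) * (θ u + b) * (θ u + c)

-- Write `θ` as s + p with p² = 1. On average only s² and the constants survive; s² contributes n
-- and p² contributes 1, which together form the second moment n + 1.
∑-cubic : ∀ {n} → 3 ≤ n → ∀ a b c →
          ∑ n (cubic a b c) ≡ + (2 ℕ.^ n) * ((a + b + c) * + suc n + a * b * c)
∑-cubic {n@(suc (suc (suc k)))} (s≤s (s≤s (s≤s z≤n))) a b c = begin
  ∑ n (cubic a b c)
    ≡⟨ ∑-cong n (λ u → trans
         (cong (λ t → (t + a) * (t + b) * (t + c)) (θ-signSum u))
         (trans (expand (signSum u) (χ u 𝟏) a b c) (cong (normal (signSum u) (χ u 𝟏)) (χ² u 𝟏)))) ⟩
  ∑ n (λ u → normal (signSum u) (χ u 𝟏) 1ℤ)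
    ≡⟨ trans (∑-drop n 1ℤ (∑-s³ n))
         (trans (∑-drop n (+ 3) (∑-s²p k))
         (trans (∑-drop n (+ 3 * 1ℤ + e₂) (∑-s n))
         (trans (∑-drop n (1ℤ + e₂) (∑-p (2 ℕ.+ k)))
         (trans (∑-drop n (+ 2 * (a + b + c)) (∑-sp (suc k)))
         (∑-+ n _ _))))) ⟩
  ∑ n (λ u → (a + b + c) * (signSum u * signSum u)) + ∑ n (λ _ → ((a + b + c) * 1ℤ + a * b * c) * 1ℤ)
    ≡⟨ cong₂ _+_ (trans (∑-* n (a + b + c) _) (cong ((a + b + c) *_) (∑-s² n)))
                 (trans (∑-* n ((a + b + c) * 1ℤ + a * b * c) _) (cong (((a + b + c) * 1ℤ + a * b * c) *_) (∑-1 n))) ⟩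
  (a + b + c) * (+ n * + (2 ℕ.^ n)) + ((a + b + c) * 1ℤ + a * b * c) * + (2 ℕ.^ n)
    ≡⟨ collect (+ n) (+ (2 ℕ.^ n)) a b c ⟩
  + (2 ℕ.^ n) * ((a + b + c) * + suc n + a * b * c) ∎
  where
  open ≡-Reasoning
  e₂ = a * b + b * c + c * a
  -- The square of p is a separate argument so that `χ²` can replace exactly its occurrences by 1.
  normal : ℤ → ℤ → ℤ → ℤ
  normal s p p² =
    1ℤ * (s * s * s) + (+ 3 * (s * s * p) + ((+ 3 * p² + (a * b + b * c + c * a)) * s +
    ((p² + (a * b + b * c + c * a)) * p + (+ 2 * (a + b + c) * (s * p) + ((a + b + c) * (s * s) +
    ((a + b + c) * p² + a * b * c) * 1ℤ)))))
  expand : ∀ s p a b c → (s + p + a) * (s + p + b) * (s + p + c) ≡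
    1ℤ * (s * s * s) + (+ 3 * (s * s * p) + ((+ 3 * (p * p) + (a * b + b * c + c * a)) * s +
    ((p * p + (a * b + b * c + c * a)) * p + (+ 2 * (a + b + c) * (s * p) + ((a + b + c) * (s * s) +
    ((a + b + c) * (p * p) + a * b * c) * 1ℤ)))))
  expand = solve-∀
  collect : ∀ n x a b c → (a + b + c) * (n * x) + ((a + b + c) * 1ℤ + a * b * c) * x ≡
                          x * ((a + b + c) * (1ℤ + n) + a * b * c)
  collect = solve-∀

-- Adjacency and distance

e≢𝟎 : ∀ {n} (i : Fin n) → e i ≢ 𝟎
e≢𝟎 zero    ()
e≢𝟎 (suc i) eq = e≢𝟎 i (cong tail eq)

all-∷ʳ : ∀ {A : Set} {P : A → Set} {m x} {xs : Vec A m} → All P xs → P x → All P (xs ∷ʳ x)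
all-∷ʳ []        p = p ∷ []
all-∷ʳ (p′ ∷ ps) p = p′ ∷ all-∷ʳ ps p

generator≢𝟎 : ∀ {n} i → lookup (generators (suc n)) i ≢ 𝟎
generator≢𝟎 {n} = All.lookup⁺ (all-∷ʳ {P = _≢ 𝟎} (All.tabulate⁺ e≢𝟎) 𝟏≢𝟎)

∣I∣≡0⇒∉ : ∀ {m} {I : Subset m} {i} → ∣ I ∣ ≡ 0 → i ∈ˢ I → ∀ {A : Set} → A
∣I∣≡0⇒∉ {I = false ∷ I} eq (there i∈I) = ∣I∣≡0⇒∉ eq i∈I

span-∅ : ∀ {n} {I : Subset (suc n)} → ∣ I ∣ ≡ 0 → ∀ {x} → Span (⋃F I) x → x ≡ 𝟎
span-∅ ∅ (gen (_ , i∈I , _)) = ∣I∣≡0⇒∉ ∅ i∈I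
span-∅ ∅ zeroˢ = refl
span-∅ ∅ (s +ˢ t) = trans (cong₂ _⊕_ (span-∅ ∅ s) (span-∅ ∅ t)) (⊕-self 𝟎)
span-∅ ∅ (true ·ˢ s) = trans (true· _) (span-∅ ∅ s)
span-∅ ∅ (false ·ˢ s) = false· _

-- A singleton index set gives weight at most 1, and weight 0 would place the generator in the span
-- of nothing. This supplies the edges along which `orthogonal-θ` extends walks.
w-pr-generator : ∀ {n} i → w-pr (lookup (generators (suc n)) i) ≡ 1
w-pr-generator i with weight (lookup (generators _) i)
... | w , _ , least
    with least {1} (⁅ i ⁆ , ∣⁅x⁆∣≡1 i , gen (i , x∈⁅x⁆ i , gen refl))
w-pr-generator i | 0 , (_ , ∅ , s) , _ | _       = contradiction (span-∅ ∅ s) (generator≢𝟎 i)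
w-pr-generator i | 1 , _           , _ | _       = refl
w-pr-generator i | suc (suc _) , _ , _ | s≤s ()

*-≥0 : ∀ {i j} → 0ℤ ℤ.≤ i → 0ℤ ℤ.≤ j → 0ℤ ℤ.≤ i * j
*-≥0 {+ i} {+ j} _ _ = subst (0ℤ ℤ.≤_) (ℤ.pos-* i j) (+≤+ z≤n)

⊕-cancel : ∀ {n} (x y : F₂^ n) → x ⊕ (x ⊕ y) ≡ y
⊕-cancel x y = begin
  x ⊕ (x ⊕ y)  ≡⟨ ⊕-assoc x x y ⟨
  (x ⊕ x) ⊕ y  ≡⟨ cong (_⊕ y) (⊕-self x) ⟩
  𝟎 ⊕ y        ≡⟨ ⊕-identityˡ y ⟩
  y            ∎
  where open ≡-Reasoning

-- Orthogonality beyond a distance and the ratio bound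

module _ {n : ℕ} where
  open Graph (G-pr (suc n)) using (_~_; []; _∷_; Distance>; IsIndependent; HasIndependentSet; _,_)

  ~-generator : ∀ x i → x ~ x ⊕ lookup (generators (suc n)) i
  ~-generator x i = trans (cong w-pr (⊕-cancel x (lookup (generators _) i))) (w-pr-generator i)

  -- Up to the factor `2 ^ suc n`, the sum is the entry at `x`, `y` of the translation-invariant
  -- matrix with eigenvalue `w u` at the character `χ u`. The condition is thus that this matrix
  -- vanishes beyond distance `l`.
  OrthogonalBeyond : ℕ → (F₂^ suc n → ℤ) → Set
  OrthogonalBeyond l w = ∀ {x y} → Distance> l x y → ∑ (suc n) (λ u → w u * χ u (x ⊕ y)) ≡ 0ℤ

  -- The matrix is the identity here: the empty walk rules out `x ≡ y`, leaving an off-diagonal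
  -- entry.
  orthogonal-1 : OrthogonalBeyond 0 (λ _ → 1ℤ)
  orthogonal-1 {x} {y} far = trans (∑-cong (suc n) λ u → ℤ.*-identityˡ (χ u (x ⊕ y)))
    (χ-orthogonal (suc n) λ x⊕y≡𝟎 → x≢y (begin
      x            ≡⟨ ⊕-identityʳ x ⟨
      x ⊕ 𝟎        ≡⟨ cong (x ⊕_) x⊕y≡𝟎 ⟨
      x ⊕ (x ⊕ y)  ≡⟨ ⊕-cancel x y ⟩
      y            ∎))
    where
    open ≡-Reasoning
    x≢y : x ≢ y
    x≢y refl = contradiction (far []) λ ()

  -- Multiplying by θ in Fourier space averages over the neighbours.
  orthogonal-θ : ∀ {l} w c → OrthogonalBeyond l w → OrthogonalBeyond (suc l) (λ u → w u * (θ u + c))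
  orthogonal-θ {l} w c orth {x} {y} far = begin
    ∑ (suc n) (λ u → w u * (θ u + c) * χ u (x ⊕ y))
      ≡⟨ ∑-cong (suc n) (λ u → expand (w u) (θ u) c (χ u (x ⊕ y))) ⟩
    ∑ (suc n) (λ u → c * (w u * χ u (x ⊕ y)) + w u * χ u (x ⊕ y) * θ u)
      ≡⟨ ∑-drop (suc n) c (orth λ walk → ℕ.<-trans (ℕ.n<1+n l) (far walk)) ⟩
    ∑ (suc n) (λ u → w u * χ u (x ⊕ y) * θ u)
      ≡⟨ ∑-hat (λ u → w u * χ u (x ⊕ y)) (All.lookup⁻ λ i → trans
           (∑-cong (suc n) λ u → shift u (lookup (generators (suc n)) i))
           -- A walk to `y` from the neighbour of `x`, extended by the edge to `x`, is one longer;
           -- hence the neighbour is still farther than `l` from `y`.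
           (orth λ walk → ℕ.s≤s⁻¹ (far (~-generator x i ∷ walk)))) ⟩
    0ℤ ∎
    where
    open ≡-Reasoning
    expand : ∀ w t c a → w * (t + c) * a ≡ c * (w * a) + w * a * t
    expand = solve-∀
    perm : ∀ w a b g → w * (a * b) * g ≡ w * (a * g * b)
    perm = solve-∀
    shift : ∀ u g → w u * χ u (x ⊕ y) * χ u g ≡ w u * χ u (x ⊕ g ⊕ y)
    shift u g = begin
      w u * χ u (x ⊕ y) * χ u g        ≡⟨ cong (λ a → w u * a * χ u g) (χ-⊕ u x y) ⟩
      w u * (χ u x * χ u y) * χ u g    ≡⟨ perm (w u) (χ u x) (χ u y) (χ u g) ⟩
      w u * (χ u x * χ u g * χ u y)    ≡⟨ cong (λ a → w u * (a * χ u y)) (χ-⊕ u x g) ⟨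
      w u * (χ u (x ⊕ g) * χ u y)      ≡⟨ cong (w u *_) (χ-⊕ u (x ⊕ g) y) ⟨
      w u * χ u (x ⊕ g ⊕ y)            ∎

  -- Each of the three linear factors costs one unit of distance, starting from the constant 1; the
  -- inserted `1ℤ` is this starting weight.
  orthogonal-cubic : ∀ a b c → OrthogonalBeyond 3 (cubic a b c)
  orthogonal-cubic a b c {x} {y} far = trans
    (∑-cong (suc n) λ u → cong (λ t → t * (θ u + b) * (θ u + c) * χ u (x ⊕ y)) (sym (ℤ.*-identityˡ (θ u + a))))
    (orthogonal-θ (λ u → 1ℤ * (θ u + a) * (θ u + b)) c
      (orthogonal-θ (λ u → 1ℤ * (θ u + a)) b
        (orthogonal-θ (λ _ → 1ℤ) a orthogonal-1)) far)

  independent⇒pairs : ∀ {k m} {xs : Vec (F₂^ suc n) m} → IsIndependent k xs → AllPairs (Distance> k) xs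
  independent⇒pairs ([] , _) = []
  independent⇒pairs (x≢xs ∷ u , far) =
    allOf∈ (λ y∈xs → far (Any.here refl) (Any.there y∈xs) (All.lookup x≢xs y∈xs)) ∷
    independent⇒pairs (u , λ x∈ y∈ → far (Any.there x∈) (Any.there y∈))

  cubic-bound : 3 ≤ suc n → ∀ {m} → HasIndependentSet 3 m →
    ∀ a b c → (∀ (u : F₂^ suc n) → 0ℤ ℤ.≤ cubic a b c u) →
    + m * ((+ (2 ℕ.+ n) + a) * (+ (2 ℕ.+ n) + b) * (+ (2 ℕ.+ n) + c)) ℤ.≤
    + (2 ℕ.^ suc n) * ((a + b + c) * + (2 ℕ.+ n) + a * b * c)
  -- For the empty set there is no factor `m` to cancel; the claim is then that the sum of the cubic
  -- is nonnegative.
  cubic-bound n≥3 {zero} _ a b c q≥0 = begin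
    0ℤ                       ≤⟨ q≥0 𝟎 ⟩
    cubic {suc n} a b c 𝟎            ≤⟨ term≤∑ (suc n) q≥0 ⟩
    ∑ (suc n) (cubic a b c)  ≡⟨ ∑-cubic n≥3 a b c ⟩
    _                        ∎
    where open ℤ.≤-Reasoning
  cubic-bound n≥3 {m@(suc _)} (xs , ind) a b c q≥0 = ℤ.*-cancelˡ-≤-pos _ _ (+ m) (begin
    + m * (+ m * ((N + a) * (N + b) * (N + c)))
      ≡⟨ perm (+ m) ((N + a) * (N + b) * (N + c)) ⟩
    (N + a) * (N + b) * (N + c) * (+ m * + m)
      -- At the trivial character `θ` is the number `N` of generators and `hat xs` is the size `m`
      -- of the set.
      ≡⟨ cong₂ (λ t h → (t + a) * (t + b) * (t + c) * (h * h)) (hat-𝟎 (generators (suc n))) (hat-𝟎 xs) ⟨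
    cubic {suc n} a b c 𝟎 * (hat xs 𝟎 * hat xs 𝟎)
      ≤⟨ term≤∑ (suc n) (λ u → *-≥0 (q≥0 u) (square≥0 (hat xs u))) ⟩
    ∑ (suc n) (λ u → cubic a b c u * (hat xs u * hat xs u))
      ≡⟨ ∑-hat² (cubic a b c) (AllPairs.map (orthogonal-cubic a b c) (independent⇒pairs ind)) ⟩
    + m * ∑ (suc n) (cubic a b c)
      ≡⟨ cong (+ m *_) (∑-cubic n≥3 a b c) ⟩
    + m * (+ (2 ℕ.^ suc n) * ((a + b + c) * N + a * b * c)) ∎)
    where
    open ℤ.≤-Reasoning
    N = + (2 ℕ.+ n)
    perm : ∀ m q → m * (m * q) ≡ q * (m * m)
    perm = solve-∀
    square≥0 : ∀ i → 0ℤ ℤ.≤ i * i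
    square≥0 (+ i)    = *-≥0 {+ i} {+ i} (+≤+ z≤n) (+≤+ z≤n)
    square≥0 -[1+ i ] = +≤+ z≤n

  -- θ u = N - 4j with 2j ≤ N = n + 2, so the three linear factors of the cubic are
  -- 4(J - j), 4(m - j) and 4(m - j + 1); the last two are multiples of consecutive integers.
  -- The best choice is J = ⌊N/2⌋ and m = ⌊N/4⌋.
  ratio-bound : 3 ≤ suc n → ∀ J m → suc n ≤ 2 ℕ.* J → ∀ {k} → HasIndependentSet 3 k →
    let N = + (2 ℕ.+ n)
        a = + 4 * + J - N
        b = + 4 * + m - N
        c = + 4 * + m + + 4 - N
    in + k * ((N + a) * (N + b) * (N + c)) ℤ.≤ + (2 ℕ.^ suc n) * ((a + b + c) * N + a * b * c)
  ratio-bound n≥3 J m n<2J ind = cubic-bound n≥3 ind _ _ _ q≥0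
    where
    N = + (2 ℕ.+ n)
    pronic≥0 : ∀ i → 0ℤ ℤ.≤ i * (i + 1ℤ)
    pronic≥0 (+ i)          = *-≥0 {+ i} {+ i + 1ℤ} (+≤+ z≤n) (+≤+ z≤n)
    pronic≥0 -[1+ zero ]    = +≤+ z≤n
    pronic≥0 -[1+ suc i ]   = +≤+ z≤n
    factor : ∀ N J m j →
      (N - + 4 * j + (+ 4 * J - N)) * (N - + 4 * j + (+ 4 * m - N)) * (N - + 4 * j + (+ 4 * m + + 4 - N)) ≡
      + 64 * ((J - j) * ((m - j) * (m - j + 1ℤ)))
    factor = solve-∀
    q≥0 : ∀ (u : F₂^ suc n) → 0ℤ ℤ.≤ cubic (+ 4 * + J - N) (+ 4 * + m - N) (+ 4 * + m + + 4 - N) u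
    q≥0 u with j , 2j≤N , eq ← θ-values u = subst (0ℤ ℤ.≤_)
      (sym (trans (cong (λ t → (t + (+ 4 * + J - N)) * (t + (+ 4 * + m - N)) * (t + (+ 4 * + m + + 4 - N))) eq)
                  (factor N (+ J) (+ m) (+ j))))
      (*-≥0 {+ 64} (+≤+ z≤n) (*-≥0 (ℤ.i≤j⇒0≤j-i (+≤+ j≤J)) (pronic≥0 (+ m - + j))))
      where
      -- From 2j ≤ n + 2 ≤ 2J + 1 by integrality; the slack of one lets the same argument cover `N`
      -- even and `N` odd.
      j≤J : j ≤ J
      j≤J = ℕ.≤-pred (ℕ.*-cancelˡ-< 2 j (suc J) (begin-strict
        2 ℕ.* j        ≤⟨ 2j≤N ⟩
        2 ℕ.+ n        ≤⟨ s≤s n<2J ⟩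
        1 ℕ.+ 2 ℕ.* J  <⟨ ℕ.n<1+n _ ⟩
        2 ℕ.+ 2 ℕ.* J  ≡⟨ ℕ.*-suc 2 J ⟨
        2 ℕ.* suc J    ∎))
        where open ℕ.≤-Reasoning

-- Clearing denominators

fraction-≤ : ∀ {k} P p d .{{_ : NonZero d}} → k ℕ.* d ≤ P ℕ.* p →
             (+ k) ℚᵘ./ 1 ℚᵘ.≤ ((+ P) ℚᵘ./ 1) ℚᵘ.* ((+ p) ℚᵘ./ d)
fraction-≤ {k} P p d@(suc d′) le = ℚᵘ.*≤* (begin
  + k * + suc (d′ ℕ.+ 0)  ≡⟨ cong (λ x → + k * + suc x) (ℕ.+-identityʳ d′) ⟩
  + k * + d               ≡⟨ ℤ.pos-* k d ⟨
  + (k ℕ.* d)             ≤⟨ +≤+ le ⟩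
  + (P ℕ.* p)             ≡⟨ ℤ.pos-* P p ⟩
  + P * + p               ≡⟨ ℤ.*-identityʳ _ ⟨
  + P * + p * 1ℤ          ∎)
  where open ℤ.≤-Reasoning

-- Reduces a residue class to two polynomial identities: the value of the cubic at `N` is `s * d`,
-- and twice its average over all characters is `s * p`. The common factor `s` cancels; the 2 comes
-- from `2 ^ suc n`, as the target has only `2 ^ n`.
scaled-ratio-bound : ∀ {n} → 3 ≤ suc n → ∀ J m → suc n ≤ 2 ℕ.* J →
  ∀ {k} → Graph.HasIndependentSet (G-pr (suc n)) 3 k →
  let N = + (2 ℕ.+ n) in
  ∀ s .{{_ : ℤ.Positive s}} p d →
  + 64 * (+ J * (+ m * (+ m + 1ℤ))) ≡ s * + d →
  + 2 * ((+ 4 * + J + + 8 * + m + + 4 - + 3 * N) * N +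
         (+ 4 * + J - N) * (+ 4 * + m - N) * (+ 4 * + m + + 4 - N)) ≡ s * + p →
  k ℕ.* d ≤ 2 ℕ.^ n ℕ.* p
scaled-ratio-bound {n} n≥3 J m n<2J {k} ind s p d Q≡ D≡ = ℤ.drop‿+≤+ (ℤ.*-cancelˡ-≤-pos _ _ s (begin
  s * + (k ℕ.* d)                  ≡⟨ cong (s *_) (ℤ.pos-* k d) ⟩
  s * (+ k * + d)                  ≡⟨ perm s (+ k) (+ d) ⟩
  + k * (s * + d)                  ≡⟨ cong (+ k *_) Q≡ ⟨
  + k * (+ 64 * (+ J * (+ m * (+ m + 1ℤ))))
    ≡⟨ cong (+ k *_) (product N (+ J) (+ m)) ⟨
  + k * ((N + a) * (N + b) * (N + c))
    ≤⟨ ratio-bound n≥3 J m n<2J ind ⟩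
  + (2 ℕ.^ suc n) * ((a + b + c) * N + a * b * c)
    ≡⟨ cong₂ _*_ (ℤ.pos-* 2 (2 ℕ.^ n)) (cong (λ t → t * N + a * b * c) (sum N (+ J) (+ m))) ⟩
  + 2 * + (2 ℕ.^ n) * D            ≡⟨ swap (+ (2 ℕ.^ n)) D ⟩
  + (2 ℕ.^ n) * (+ 2 * D)          ≡⟨ cong (+ (2 ℕ.^ n) *_) D≡ ⟩
  + (2 ℕ.^ n) * (s * + p)          ≡⟨ perm (+ (2 ℕ.^ n)) s (+ p) ⟩
  s * (+ (2 ℕ.^ n) * + p)          ≡⟨ cong (s *_) (ℤ.pos-* (2 ℕ.^ n) p) ⟨
  s * + (2 ℕ.^ n ℕ.* p)            ∎))
  where
  open ℤ.≤-Reasoning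
  N = + (2 ℕ.+ n)
  a = + 4 * + J - N
  b = + 4 * + m - N
  c = + 4 * + m + + 4 - N
  D = (+ 4 * + J + + 8 * + m + + 4 - + 3 * N) * N + a * b * c
  perm : ∀ a b c → a * (b * c) ≡ b * (a * c)
  perm = solve-∀
  swap : ∀ a b → + 2 * a * b ≡ a * (+ 2 * b)
  swap = solve-∀
  product : ∀ N J m → (N + (+ 4 * J - N)) * (N + (+ 4 * m - N)) * (N + (+ 4 * m + + 4 - N)) ≡
                      + 64 * (J * (m * (m + 1ℤ)))
  product = solve-∀
  sum : ∀ N J m → + 4 * J - N + (+ 4 * m - N) + (+ 4 * m + + 4 - N) ≡
                  + 4 * J + + 8 * m + + 4 - + 3 * N
  sum = solve-∀

-- The four residue classes modulo 4

pos-^2∸ : ∀ m → + (suc m ℕ.^ 2 ℕ.∸ suc m ℕ.+ 4) ≡ + suc m * + m + + 4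
pos-^2∸ m = cong (_+ + 4) (trans (cong +_ eq) (ℤ.pos-* (suc m) m))
  where
  open ≡-Reasoning
  eq : suc m ℕ.^ 2 ℕ.∸ suc m ≡ suc m ℕ.* m
  eq = begin
    suc m ℕ.* (suc m ℕ.* 1) ℕ.∸ suc m        ≡⟨ cong (λ x → suc m ℕ.* x ℕ.∸ suc m) (ℕ.*-identityʳ (suc m)) ⟩
    suc m ℕ.* suc m ℕ.∸ suc m                ≡⟨ cong (ℕ._∸ suc m) (ℕ.*-suc (suc m) m) ⟩
    suc m ℕ.+ suc m ℕ.* m ℕ.∸ suc m          ≡⟨ ℕ.m+n∸m≡n (suc m) _ ⟩
    suc m ℕ.* m                              ∎

-- A repeated sum, unlike a product, makes `+ four k` unfold by computation to sums of `+ k`, the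
-- form of the ring identities below.
four : ℕ → ℕ
four k = k ℕ.+ k ℕ.+ (k ℕ.+ k)

-- With `N = n + 1`, the arguments ⌊N/2⌋ and ⌊N/4⌋ give the roots 1 - n, -3 and 1.
bound-0 : ∀ {k M} n≥5 → Graph.HasIndependentSet (G-pr (8 ℕ.+ four k)) 3 M →
          (+ M) ℚᵘ./ 1 ℚᵘ.≤ bound (8 ℕ.+ four k) n≥5 0F
bound-0 {k} n≥5 ind = fraction-≤ (2 ℕ.^ (7 ℕ.+ four k)) p d {{den₀ n≥5}}
  (scaled-ratio-bound (s≤s (s≤s (s≤s z≤n))) (4 ℕ.+ (k ℕ.+ k)) (2 ℕ.+ k)
    (ℕ.≤-reflexive (eq k)) ind s p d
    (trans (Q≡ (+ k)) (cong (s *_) (sym den)))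
    (trans (D≡ (+ k)) (cong (s *_) (sym (pos-^2∸ (7 ℕ.+ four k))))))
  where
  n = 8 ℕ.+ four k
  p = n ℕ.^ 2 ℕ.∸ n ℕ.+ 4
  d = n ℕ.^ 2 ℕ.* (n ℕ.+ 4)
  s = + 2
  den : + d ≡ + n * + n * (+ n + + 4)
  den = trans (ℤ.pos-* (n ℕ.^ 2) (n ℕ.+ 4)) (cong (_* (+ n + + 4))
    (trans (cong (λ m → + (n ℕ.* m)) (ℕ.*-identityʳ n)) (ℤ.pos-* n n)))
  eq : ∀ k → 8 ℕ.+ (k ℕ.+ k ℕ.+ (k ℕ.+ k)) ≡ 2 ℕ.* (4 ℕ.+ (k ℕ.+ k))
  eq = ℕ-solve-∀
  Q≡ : ∀ x → let y = x + x + (x + x); J = + 4 + (x + x); m = + 2 + x in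
    + 64 * (J * (m * (m + 1ℤ))) ≡ + 2 * ((+ 8 + y) * (+ 8 + y) * (+ 8 + y + + 4))
  Q≡ = solve-∀
  D≡ : ∀ x → let y = x + x + (x + x); N = + 9 + y; J = + 4 + (x + x); m = + 2 + x in
    + 2 * ((+ 4 * J + + 8 * m + + 4 - + 3 * N) * N +
           (+ 4 * J - N) * (+ 4 * m - N) * (+ 4 * m + + 4 - N)) ≡
    + 2 * ((+ 8 + y) * (+ 7 + y) + + 4)
  D≡ = solve-∀

-- The roots are -(n + 1), -2 and 2; the common factor `s` is 2(n + 1).
bound-1 : ∀ {k M} n≥5 → Graph.HasIndependentSet (G-pr (5 ℕ.+ four k)) 3 M →
          (+ M) ℚᵘ./ 1 ℚᵘ.≤ bound (5 ℕ.+ four k) n≥5 1F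
bound-1 {k} n≥5 ind = fraction-≤ (2 ℕ.^ (4 ℕ.+ four k)) p d {{den₁ n≥5}}
  (scaled-ratio-bound (s≤s (s≤s (s≤s z≤n))) (3 ℕ.+ (k ℕ.+ k)) (1 ℕ.+ k)
    (ℕ.≤-trans (ℕ.n≤1+n _) (ℕ.≤-reflexive (eq k))) ind s p d
    (trans (Q≡ (+ k)) (cong (s *_) (sym (ℤ.pos-* (4 ℕ.+ four k) (n ℕ.+ 3)))))
    (D≡ (+ k)))
  where
  n = 5 ℕ.+ four k
  p = 2 ℕ.+ four k
  d = (4 ℕ.+ four k) ℕ.* (n ℕ.+ 3)
  s = + 2 * + (6 ℕ.+ four k)
  eq : ∀ k → 6 ℕ.+ (k ℕ.+ k ℕ.+ (k ℕ.+ k)) ≡ 2 ℕ.* (3 ℕ.+ (k ℕ.+ k))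
  eq = ℕ-solve-∀
  Q≡ : ∀ x → let y = x + x + (x + x); J = + 3 + (x + x); m = + 1 + x in
    + 64 * (J * (m * (m + 1ℤ))) ≡ (+ 2 * (+ 6 + y)) * ((+ 4 + y) * (+ 5 + y + + 3))
  Q≡ = solve-∀
  D≡ : ∀ x → let y = x + x + (x + x); N = + 6 + y; J = + 3 + (x + x); m = + 1 + x in
    + 2 * ((+ 4 * J + + 8 * m + + 4 - + 3 * N) * N +
           (+ 4 * J - N) * (+ 4 * m - N) * (+ 4 * m + + 4 - N)) ≡
    (+ 2 * (+ 6 + y)) * (+ 2 + y)
  D≡ = solve-∀

-- The roots are 1 - n, -1 and 3; the common factor `s` is 2n.
bound-2 : ∀ {k M} n≥5 → Graph.HasIndependentSet (G-pr (6 ℕ.+ four k)) 3 M →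
          (+ M) ℚᵘ./ 1 ℚᵘ.≤ bound (6 ℕ.+ four k) n≥5 2F
bound-2 {k} n≥5 ind = fraction-≤ (2 ℕ.^ (5 ℕ.+ four k)) p d {{den₂ n≥5}}
  (scaled-ratio-bound (s≤s (s≤s (s≤s z≤n))) (3 ℕ.+ (k ℕ.+ k)) (1 ℕ.+ k)
    (ℕ.≤-reflexive (eq k)) ind s p d
    (trans (Q≡ (+ k)) (cong (s *_) (sym (ℤ.pos-* (n ℕ.+ 2) (4 ℕ.+ four k)))))
    (D≡ (+ k)))
  where
  n = 6 ℕ.+ four k
  p = 1 ℕ.+ four k
  d = (n ℕ.+ 2) ℕ.* (4 ℕ.+ four k)
  s = + 2 * + (6 ℕ.+ four k)
  eq : ∀ k → 6 ℕ.+ (k ℕ.+ k ℕ.+ (k ℕ.+ k)) ≡ 2 ℕ.* (3 ℕ.+ (k ℕ.+ k))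
  eq = ℕ-solve-∀
  Q≡ : ∀ x → let y = x + x + (x + x); J = + 3 + (x + x); m = + 1 + x in
    + 64 * (J * (m * (m + 1ℤ))) ≡ (+ 2 * (+ 6 + y)) * ((+ 6 + y + + 2) * (+ 4 + y))
  Q≡ = solve-∀
  D≡ : ∀ x → let y = x + x + (x + x); N = + 7 + y; J = + 3 + (x + x); m = + 1 + x in
    + 2 * ((+ 4 * J + + 8 * m + + 4 - + 3 * N) * N +
           (+ 4 * J - N) * (+ 4 * m - N) * (+ 4 * m + + 4 - N)) ≡
    (+ 2 * (+ 6 + y)) * (+ 1 + y)
  D≡ = solve-∀

-- The roots are -(n + 1), -4 and 0; the common factor `s` is 2(n + 1)(n + 5).
bound-3 : ∀ {k M} n≥5 → Graph.HasIndependentSet (G-pr (7 ℕ.+ four k)) 3 M →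
          (+ M) ℚᵘ./ 1 ℚᵘ.≤ bound (7 ℕ.+ four k) n≥5 3F
bound-3 {k} n≥5 ind = fraction-≤ (2 ℕ.^ (6 ℕ.+ four k)) p d {{den₃ n}}
  (scaled-ratio-bound (s≤s (s≤s (s≤s z≤n))) (4 ℕ.+ (k ℕ.+ k)) (2 ℕ.+ k)
    (ℕ.≤-trans (ℕ.n≤1+n _) (ℕ.≤-reflexive (eq k))) ind s p d
    (Q≡ (+ k))
    (D≡ (+ k)))
  where
  n = 7 ℕ.+ four k
  p = 1
  d = n ℕ.+ 1
  s = + 2 * (+ (8 ℕ.+ four k) * + (12 ℕ.+ four k))
  eq : ∀ k → 8 ℕ.+ (k ℕ.+ k ℕ.+ (k ℕ.+ k)) ≡ 2 ℕ.* (4 ℕ.+ (k ℕ.+ k))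
  eq = ℕ-solve-∀
  Q≡ : ∀ x → let y = x + x + (x + x); J = + 4 + (x + x); m = + 2 + x in
    + 64 * (J * (m * (m + 1ℤ))) ≡ (+ 2 * ((+ 8 + y) * (+ 12 + y))) * (+ 7 + y + + 1)
  Q≡ = solve-∀
  D≡ : ∀ x → let y = x + x + (x + x); N = + 8 + y; J = + 4 + (x + x); m = + 2 + x in
    + 2 * ((+ 4 * J + + 8 * m + + 4 - + 3 * N) * N +
           (+ 4 * J - N) * (+ 4 * m - N) * (+ 4 * m + + 4 - N)) ≡
    (+ 2 * ((+ 8 + y) * (+ 12 + y))) * + 1
  D≡ = solve-∀

bound-by-residue : ∀ n n≥5 r q → n ≡ toℕ r ℕ.+ q ℕ.* 4 →
                   ∀ {M} → Graph.HasIndependentSet (G-pr n) 3 M →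
                   (+ M) ℚᵘ./ 1 ℚᵘ.≤ bound n n≥5 r
bound-by-residue n n≥5 r q eq = go n≥5 r q (trans eq (cong (toℕ r ℕ.+_) (quadruple q)))
  where
  quadruple : ∀ q → q ℕ.* 4 ≡ q ℕ.+ q ℕ.+ (q ℕ.+ q)
  quadruple = ℕ-solve-∀
  four-suc : ∀ q → suc q ℕ.+ suc q ℕ.+ (suc q ℕ.+ suc q) ≡ 4 ℕ.+ (q ℕ.+ q ℕ.+ (q ℕ.+ q))
  four-suc = ℕ-solve-∀
  go : ∀ {n} n≥5 r q → n ≡ toℕ r ℕ.+ four q → ∀ {M} → Graph.HasIndependentSet (G-pr n) 3 M →
       (+ M) ℚᵘ./ 1 ℚᵘ.≤ bound n n≥5 r
  go ()                          0F 0 refl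
  go (s≤s ())                    1F 0 refl
  go (s≤s (s≤s ()))              2F 0 refl
  go (s≤s (s≤s (s≤s ())))        3F 0 refl
  -- Here n = 4, still below 5: the class of 0 starts at 8, the others at 5, 6 and 7.
  go (s≤s (s≤s (s≤s (s≤s ())))) 0F 1 refl
  go n≥5 0F (suc (suc q)) eq
    with refl ← trans eq (trans (four-suc (suc q)) (cong (4 ℕ.+_) (four-suc q))) = bound-0 {q} n≥5
  go n≥5 1F (suc q) eq with refl ← trans eq (cong (1 ℕ.+_) (four-suc q)) = bound-1 {q} n≥5
  go n≥5 2F (suc q) eq with refl ← trans eq (cong (2 ℕ.+_) (four-suc q)) = bound-2 {q} n≥5
  go n≥5 3F (suc q) eq with refl ← trans eq (cong (3 ℕ.+_) (four-suc q)) = bound-3 {q} n≥5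

theorem46 : (n : ℕ) (n≥5 : 5 ≤ n) →
    (+ α 3 (G-pr n)) ℚᵘ./ 1 ℚᵘ.≤ bound n n≥5 (n mod 4)
theorem46 n n≥5 = bound-by-residue n n≥5 (n mod 4) quotient property
  -- The maximum is attained, so `α` is the size of an actual independent set.
  (proj₁ (proj₂ (Graph.independenceNumber (G-pr n) 3)))
  where open DivMod (n divMod 4)
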